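{- Let $Q=(V,E)$ be a finite simple connected graph with $|V(Q)|=n$ and $|E(Q)|=m$. Let $r,s$ be positive integers and let $p,q$ be integers with $1\le p\le r$ and $1\le q\le s$. Then the $(r,s)$-generalised transformation graph $Q_{rs}^{x(p)\,y(q)\,- }$ satisfies $$\begin{aligned} M_1\big(Q_{rs}^{x(p)\,y(q)\,- }\big)=\;&\big\{p(1-s)^2+(r-p)(s+1)^2+2q(nr-2r-2)+2(q-s)(m+r(n-2)+1)\big\}M_1(Q)\\ &+2s\,M_2(Q)+s\,F(Q)+(r-p)\big\{n(n+sm-1)^2-4m(n+sm-1)(s+1)\big\}\\ &+psm^2\big(ns+4(1-s)\big)+mq(nr-2r-2)^2+m(s-q)\big(m+r(n-2)+1\big)^2 . \end{aligned}$$
   Context: For a finite simple graph $H$, $d_H(\alpha)$ denotes the degree of the vertex $\alpha$ in $H$. The first Zagreb index is $M_1(H)=\sum_{\alpha\in V(H)}d_H(\alpha)^2$, the second Zagreb index is $M_2(H)=\sum_{\alpha\beta\in E(H)}d_H(\alpha)d_H(\beta)$, and the forgotten index is $F(H)=\sum_{\alpha\in V(H)}d_H(\alpha)^3$. All arithmetic is in the integers. Two distinct edges of $Q$ are called adjacent if they have a common end vertex; a vertex and an edge are incident if the vertex is an end vertex of the edge. $(r,s)$-generalised transformation graphs: let $Q=(V,E)$ be a finite simple connected graph and $r,s$ positive integers. Take $r$ disjoint copies $V_1,\dots,V_r$ of $V(Q)$ and $s$ disjoint copies $E_1,\dots,E_s$ of $E(Q)$. Given sign vectors $x=(x_1,\dots,x_r)$,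 $y=(y_1,\dots,y_s)$ and $z=(z_{gh})_{1\le g\le r,\,1\le h\le s}$ with all entries in $\{+,-\}$, the graph $Q_{rs}^{xyz}$ is the simple graph with vertex set $\big(\bigcup_{g=1}^r V_g\big)\cup\big(\bigcup_{h=1}^s E_h\big)$ in which two distinct vertices $\alpha,\beta$ are adjacent if and only if one of the following holds: (i) $\alpha,\beta\in V_g$ for some $g$, and (as vertices of $Q$) they are adjacent in $Q$ if $x_g=+$, respectively not adjacent in $Q$ if $x_g=-$; (ii) $\alpha,\beta\in E_h$ for some $h$, and (as edges of $Q$) they are adjacent in $Q$ if $y_h=+$, respectively not adjacent in $Q$ if $y_h=-$; (iii) $\alpha\in V_g$ and $\beta\in E_h$ (or vice versa) for some $g,h$, and (as a vertex and an edge of $Q$) they are incident in $Q$ if $z_{gh}=+$, respectively not incident in $Q$ if $z_{gh}=-$. In particular there are no edges between different copies $V_g,V_{g'}$ or between different copies $E_h,E_{h'}$. For $1\le p\le r$, $x(p)$ is the vector with $x_g=+$ for $1\le g\le p$ and $x_g=-$ for $p<g\le r$. For $1\le q\le s$, $y(q)$ is the vector with $y_h=+$ for $1\le h\le q$ and $y_h=-$ for $q<h\le s$. The graph $Q_{rs}^{x(p)\,y(q)\,- }$ is $Q_{rs}^{xyz}$ with $x=x(p)$, $y=y(q)$ and $z_{gh}=-$ for all $g,h$. -}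

module Defs where

open import Data.Bool using (if_then_else_)
open import Data.Fin using (Fin; toℕ)
import Data.Fin.Properties as Fin
open import Data.List using (List; []; _∷_; _++_; map; filter; length; lookup; allFin; cartesianProduct)
open import Data.List.Membership.Propositional using (_∈_)
open import Data.List.Membership.Propositional.Properties
  using (∈-map⁺; ∈-map⁻; ∈-++⁺ˡ; ∈-++⁺ʳ; ∈-allFin; ∈-cartesianProduct⁺)
open import Data.List.Relation.Unary.Unique.Propositional using (Unique)
import Data.List.Relation.Unary.Unique.Propositional.Properties as Unique
open import Data.Nat using (ℕ; _*_; _^_; _<ᵇ_)
open import Data.Nat.ListAction using (sum)
open import Data.Product using (∃; _×_; _,_; proj₁; proj₂)
open import Data.Product.Properties using () renaming (≡-dec to ×-≡-dec)
open import Data.Sign using (Sign)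
open import Data.Sum using (_⊎_; inj₁; inj₂)
open import Data.Sum.Properties using (inj₁-injective; inj₂-injective) renaming (≡-dec to ⊎-≡-dec)
open import Data.Vec.Functional using (Vector)
open import Function using (_∘_)
open import Relation.Binary.Construct.Closure.ReflexiveTransitive using (Star)
open import Relation.Binary.Definitions using (Decidable; DecidableEquality; Symmetric)
open import Relation.Binary.PropositionalEquality using (_≡_; _≢_; refl; sym)
open import Relation.Nullary using (¬_; Dec)
open import Relation.Nullary.Decidable using (map′; ¬?; _×-dec_; _⊎-dec_)

-- Each two-element subset of the entries of a repetition-free list is listed
-- once, as the pair (x , y) with x occurring before y.
pairs : {A : Set} → List A → List (A × A)
pairs []       = []
pairs (x ∷ xs) = map (x ,_) xs ++ pairs xs

record Graph : Set₁ where
  infix 4 _≟_ _~_ _~?_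
  field
    V        : Set
    _≟_      : DecidableEquality V
    vertices : List V
    unique   : Unique vertices
    complete : ∀ v → v ∈ vertices
    _~_      : V → V → Set
    _~?_     : Decidable _~_
    ~-sym    : Symmetric _~_
    ~-irrefl : ∀ {v} → ¬ (v ~ v)

  order : ℕ
  order = length vertices

  edges : List (V × V)
  edges = filter (λ (u , v) → u ~? v) (pairs vertices)

  size : ℕ
  size = length edges

  degree : V → ℕ
  degree v = length (filter (v ~?_) vertices)

  -- An edge is a position in the list `edges`, which has no repetitions.
  E : Set
  E = Fin size

  ends : E → V × V
  ends = lookup edges

  Incident : V → E → Set
  Incident v e = v ≡ proj₁ (ends e) ⊎ v ≡ proj₂ (ends e)

  incident? : Decidable Incident
  incident? v e = (v ≟ proj₁ (ends e)) ⊎-dec (v ≟ proj₂ (ends e))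

  AdjacentEdges : E → E → Set
  AdjacentEdges e f = e ≢ f × ∃ λ v → Incident v e × Incident v f

  adjacentEdges? : Decidable AdjacentEdges
  adjacentEdges? e f = ¬? (e Fin.≟ f) ×-dec
    map′ to from (incident? (proj₁ (ends e)) f ⊎-dec incident? (proj₂ (ends e)) f)
    where
    to : Incident (proj₁ (ends e)) f ⊎ Incident (proj₂ (ends e)) f →
         ∃ λ v → Incident v e × Incident v f
    to (inj₁ i) = _ , inj₁ refl , i
    to (inj₂ i) = _ , inj₂ refl , i

    from : (∃ λ v → Incident v e × Incident v f) →
           Incident (proj₁ (ends e)) f ⊎ Incident (proj₂ (ends e)) f
    from (_ , inj₁ refl , i) = inj₁ i
    from (_ , inj₂ refl , i) = inj₂ i

  adjacentEdges-sym : Symmetric AdjacentEdges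
  adjacentEdges-sym (e≢f , v , i , j) = e≢f ∘ sym , v , j , i

open Graph using (order; size) public

Connected : Graph → Set
Connected Q = V × (∀ u v → Star _~_ u v)
  where open Graph Q

M₁ : Graph → ℕ
M₁ H = sum (map (λ v → degree v ^ 2) vertices)
  where open Graph H

M₂ : Graph → ℕ
M₂ H = sum (map (λ (u , v) → degree u * degree v) edges)
  where open Graph H

F : Graph → ℕ
F H = sum (map (λ v → degree v ^ 3) vertices)
  where open Graph H

Signed : Sign → Set → Set
Signed Sign.+ P = P
Signed Sign.- P = ¬ P

signed? : ∀ σ {P} → Dec P → Dec (Signed σ P)
signed? Sign.+ = λ P? → P?
signed? Sign.- = ¬?

signed-map : ∀ σ {P P′} → (P → P′) → (P′ → P) → Signed σ P → Signed σ P′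
signed-map Sign.+ f g = f
signed-map Sign.- f g = _∘ g

module Transformation (Q : Graph) {r s : ℕ}
  (x : Vector Sign r) (y : Vector Sign s) (z : Fin r → Fin s → Sign) where

  open Graph Q hiding (order; size)

  -- inj₁ (g , v) is the vertex v in the copy V_g, and inj₂ (h , e) the edge e
  -- in the copy E_h.
  V′ : Set
  V′ = (Fin r × V) ⊎ (Fin s × E)

  _≟′_ : DecidableEquality V′
  _≟′_ = ⊎-≡-dec (×-≡-dec Fin._≟_ _≟_) (×-≡-dec Fin._≟_ Fin._≟_)

  vertices′ : List V′
  vertices′ = map inj₁ (cartesianProduct (allFin r) vertices)
           ++ map inj₂ (cartesianProduct (allFin s) (allFin (size Q)))

  unique′ : Unique vertices′
  unique′ = Unique.++⁺
    (Unique.map⁺ inj₁-injective (Unique.cartesianProduct⁺ (Unique.allFin⁺ r) unique))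
    (Unique.map⁺ inj₂-injective (Unique.cartesianProduct⁺ (Unique.allFin⁺ s) (Unique.allFin⁺ _)))
    disjoint
    where
    disjoint : ∀ {xs ys} {α : V′} → ¬ (α ∈ map inj₁ xs × α ∈ map inj₂ ys)
    disjoint (i , j) with ∈-map⁻ inj₁ i | ∈-map⁻ inj₂ j
    ... | _ , _ , refl | _ , _ , ()

  complete′ : ∀ α → α ∈ vertices′
  complete′ (inj₁ (g , v)) =
    ∈-++⁺ˡ (∈-map⁺ inj₁ (∈-cartesianProduct⁺ (∈-allFin g) (complete v)))
  complete′ (inj₂ (h , e)) =
    ∈-++⁺ʳ _ (∈-map⁺ inj₂ (∈-cartesianProduct⁺ (∈-allFin h) (∈-allFin e)))

  Linked : V′ → V′ → Set
  Linked (inj₁ (g , u)) (inj₁ (g′ , v)) = g ≡ g′ × Signed (x g) (u ~ v)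
  Linked (inj₂ (h , e)) (inj₂ (h′ , f)) = h ≡ h′ × Signed (y h) (AdjacentEdges e f)
  Linked (inj₁ (g , v)) (inj₂ (h  , e)) = Signed (z g h) (Incident v e)
  Linked (inj₂ (h , e)) (inj₁ (g  , v)) = Signed (z g h) (Incident v e)

  linked? : Decidable Linked
  linked? (inj₁ (g , u)) (inj₁ (g′ , v)) = (g Fin.≟ g′) ×-dec signed? (x g) (u ~? v)
  linked? (inj₂ (h , e)) (inj₂ (h′ , f)) = (h Fin.≟ h′) ×-dec signed? (y h) (adjacentEdges? e f)
  linked? (inj₁ (g , v)) (inj₂ (h  , e)) = signed? (z g h) (incident? v e)
  linked? (inj₂ (h , e)) (inj₁ (g  , v)) = signed? (z g h) (incident? v e)

  linked-sym : Symmetric Linked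
  linked-sym {inj₁ (g , _)} {inj₁ _} (refl , l) = refl , signed-map (x g) ~-sym ~-sym l
  linked-sym {inj₂ (h , _)} {inj₂ _} (refl , l) =
    refl , signed-map (y h) adjacentEdges-sym adjacentEdges-sym l
  linked-sym {inj₁ _} {inj₂ _} l = l
  linked-sym {inj₂ _} {inj₁ _} l = l

  graph : Graph
  graph = record
    { V        = V′
    ; _≟_      = _≟′_
    ; vertices = vertices′
    ; unique   = unique′
    ; complete = complete′
    ; _~_      = λ α β → α ≢ β × Linked α β
    ; _~?_     = λ α β → ¬? (α ≟′ β) ×-dec linked? α β
    ; ~-sym    = λ {α} (α≢β , l) → α≢β ∘ sym , linked-sym {α} l
    ; ~-irrefl = λ (α≢α , _) → α≢α refl
    }

transformation : (Q : Graph) {r s : ℕ} →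
                 Vector Sign r → Vector Sign s → (Fin r → Fin s → Sign) → Graph
transformation Q x y z = Transformation.graph Q x y z

-- + in the first k positions and - afterwards: as indices in Fin n start at 0,
-- these are the i with toℕ i < k.
firstPlus : ∀ {n} → ℕ → Vector Sign n
firstPlus k i = if toℕ i <ᵇ k then Sign.+ else Sign.-

allMinus : ∀ {r s} → Fin r → Fin s → Sign
allMinus _ _ = Sign.-

-- In the transformation graph a vertex copy of v has degree affine in d(v), and an
-- edge copy of e = ab has degree affine in D(e) = d(a) + d(b), since e is adjacent to
-- D(e) - 2 edges. Hence M₁ is a combination of ∑ d = 2m, ∑ d² = M₁, ∑ D = M₁ and
-- ∑ D² = F + 2M₂. All sums over edges come from double sums over ordered pairs of
-- vertices weighted by the Iverson bracket of adjacency.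
module Submission where

open import Defs
open import Data.Bool using (if_then_else_)
open import Data.Empty using (⊥-elim)
open import Data.Fin using (Fin; zero; suc)
import Data.Fin.Properties as Fin
open import Data.List using (List; []; _∷_; _++_; map; filter; length; lookup; allFin; cartesianProduct)
open import Data.List.Membership.Propositional using (_∈_)
open import Data.List.Membership.Propositional.Properties using (∈-filter⁻; ∈-lookup; ∈-allFin)
open import Data.List.Properties using (map-tabulate; tabulate-lookup; length-tabulate)
import Data.List.Relation.Unary.All as All
import Data.List.Relation.Unary.AllPairs as AllPairs
open import Data.List.Relation.Unary.Any using (here; there)
open import Data.List.Relation.Unary.Unique.Propositional using (Unique)
import Data.List.Relation.Unary.Unique.Propositional.Properties as Unique
import Data.Nat as ℕ
import Data.Nat.Properties as ℕ
open import Data.Nat using (ℕ; z≤n; s≤s) renaming (_≤_ to _≤ⁿ_)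
open import Data.Nat.ListAction using (sum)
open import Data.Integer using (ℤ; 0ℤ; 1ℤ; +_; _+_; _-_; -_; _*_; _^_)
open import Data.Integer.Properties
  using (pos-+; pos-*; +-assoc; +-comm; *-comm; +-identityˡ; +-identityʳ; *-identityʳ; *-identityˡ; *-zeroʳ; *-distribˡ-+; neg-distrib-+)
import Data.Integer.Solver as Integer
open import Data.Integer.Tactic.RingSolver using (solve-∀)
open import Data.Product using (_×_; _,_; proj₁; proj₂)
open import Data.Sign using (Sign)
open import Data.Sum using (inj₁; inj₂)
open import Data.Vec.Functional using (Vector)
open import Function using (_∘_; _⇔_; mk⇔)
open import Relation.Binary.Definitions using (DecidableEquality)
open import Relation.Binary.PropositionalEquality
  using (_≡_; _≢_; refl; sym; trans; cong; cong₂; subst; module ≡-Reasoning)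
open import Relation.Nullary using (¬_; Dec; yes; no; does)
open import Relation.Nullary.Decidable using (does-⇔; ¬?; _×-dec_; _⊎-dec_)
open import Relation.Unary using (Pred; Decidable)

open ≡-Reasoning

-- Iverson brackets

-- Reading off `does` makes the bracket independent of the proof carried by a decision, so decisions
-- of equivalent propositions get equal brackets.
⟦_⟧ : {P : Set} → Dec P → ℤ
⟦ P? ⟧ = if does P? then 1ℤ else 0ℤ

⟦⟧-cong : {P Q : Set} → P ⇔ Q → (P? : Dec P) (Q? : Dec Q) → ⟦ P? ⟧ ≡ ⟦ Q? ⟧
⟦⟧-cong P⇔Q P? Q? = cong (if_then 1ℤ else 0ℤ) (does-⇔ P⇔Q P? Q?)

⟦⟧-true : {P : Set} (P? : Dec P) → P → ⟦ P? ⟧ ≡ 1ℤ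
⟦⟧-true (yes _) _ = refl
⟦⟧-true (no ¬p) p = ⊥-elim (¬p p)

⟦⟧-false : {P : Set} (P? : Dec P) → ¬ P → ⟦ P? ⟧ ≡ 0ℤ
⟦⟧-false (yes p) ¬p = ⊥-elim (¬p p)
⟦⟧-false (no _)  _  = refl

⟦⟧-¬ : {P : Set} (P? : Dec P) → ⟦ ¬? P? ⟧ ≡ 1ℤ - ⟦ P? ⟧
⟦⟧-¬ (yes _) = refl
⟦⟧-¬ (no _)  = refl

⟦⟧-× : {P Q : Set} (P? : Dec P) (Q? : Dec Q) → ⟦ P? ×-dec Q? ⟧ ≡ ⟦ P? ⟧ * ⟦ Q? ⟧
⟦⟧-× (yes _) (yes _) = refl
⟦⟧-× (yes _) (no _)  = refl
⟦⟧-× (no _)  (yes _) = refl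
⟦⟧-× (no _)  (no _)  = refl

⟦⟧-⊎ : {P Q : Set} (P? : Dec P) (Q? : Dec Q) →
       ⟦ P? ⊎-dec Q? ⟧ ≡ ⟦ P? ⟧ + ⟦ Q? ⟧ - ⟦ P? ⟧ * ⟦ Q? ⟧
⟦⟧-⊎ (yes _) (yes _) = refl
⟦⟧-⊎ (yes _) (no _)  = refl
⟦⟧-⊎ (no _)  (yes _) = refl
⟦⟧-⊎ (no _)  (no _)  = refl

⟦⟧-exclusive : {P Q : Set} (P? : Dec P) (Q? : Dec Q) → ¬ (P × Q) → ⟦ P? ⟧ * ⟦ Q? ⟧ ≡ 0ℤ
⟦⟧-exclusive P? Q? ¬pq = trans (sym (⟦⟧-× P? Q?)) (⟦⟧-false (P? ×-dec Q?) ¬pq)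

-- Finite sums over lists

private
  variable
    A B : Set

∑ : List A → (A → ℤ) → ℤ
∑ []       f = 0ℤ
∑ (x ∷ xs) f = f x + ∑ xs f

syntax ∑ xs (λ x → t) = ∑[ x ∈ xs ] t
-- Between `_+_` at 6 and `_*_` at 7: a product extends the summand, while a sum or difference ends
-- it.
infixr 6.5 ∑

∑-cong-∈ : (xs : List A) {f g : A → ℤ} → (∀ {x} → x ∈ xs → f x ≡ g x) → ∑ xs f ≡ ∑ xs g
∑-cong-∈ []       eq = refl
∑-cong-∈ (x ∷ xs) eq = cong₂ _+_ (eq (here refl)) (∑-cong-∈ xs (eq ∘ there))

∑-cong : (xs : List A) {f g : A → ℤ} → (∀ x → f x ≡ g x) → ∑ xs f ≡ ∑ xs g
∑-cong xs eq = ∑-cong-∈ xs (λ {x} _ → eq x)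

∑-const : (xs : List A) (c : ℤ) → ∑ xs (λ _ → c) ≡ + length xs * c
∑-const []       c = refl
∑-const (x ∷ xs) c = begin
  c + ∑ xs (λ _ → c)        ≡⟨ cong (_+_ c) (∑-const xs c) ⟩
  c + + length xs * c       ≡⟨ step c (+ length xs) ⟩
  (1ℤ + + length xs) * c    ∎
  where
  step : ∀ c l → c + l * c ≡ (+ 1 + l) * c
  step = solve-∀

∑-zero : (xs : List A) {f : A → ℤ} → (∀ {x} → x ∈ xs → f x ≡ 0ℤ) → ∑ xs f ≡ 0ℤ
∑-zero xs eq = trans (∑-cong-∈ xs eq) (trans (∑-const xs 0ℤ) (*-zeroʳ (+ length xs)))

∑-+ : (xs : List A) (f g : A → ℤ) → ∑ xs (λ x → f x + g x) ≡ ∑ xs f + ∑ xs g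
∑-+ []       f g = refl
∑-+ (x ∷ xs) f g = begin
  f x + g x + ∑ xs (λ x → f x + g x)     ≡⟨ cong (_+_ (f x + g x)) (∑-+ xs f g) ⟩
  f x + g x + (∑ xs f + ∑ xs g)          ≡⟨ step (f x) (g x) (∑ xs f) (∑ xs g) ⟩
  f x + ∑ xs f + (g x + ∑ xs g)          ∎
  where
  step : ∀ a b c d → a + b + (c + d) ≡ a + c + (b + d)
  step = solve-∀

∑-neg : (xs : List A) (f : A → ℤ) → ∑ xs (λ x → - f x) ≡ - ∑ xs f
∑-neg []       f = refl
∑-neg (x ∷ xs) f = trans (cong (_+_ (- f x)) (∑-neg xs f)) (sym (neg-distrib-+ (f x) (∑ xs f)))

∑-- : (xs : List A) (f g : A → ℤ) → ∑ xs (λ x → f x - g x) ≡ ∑ xs f - ∑ xs g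
∑-- xs f g = trans (∑-+ xs f (-_ ∘ g)) (cong (_+_ (∑ xs f)) (∑-neg xs g))

∑-*ˡ : (xs : List A) (c : ℤ) (f : A → ℤ) → ∑ xs (λ x → c * f x) ≡ c * ∑ xs f
∑-*ˡ []       c f = sym (*-zeroʳ c)
∑-*ˡ (x ∷ xs) c f = trans (cong (_+_ (c * f x)) (∑-*ˡ xs c f)) (sym (*-distribˡ-+ c (f x) (∑ xs f)))

∑-++ : (xs ys : List A) (f : A → ℤ) → ∑ (xs ++ ys) f ≡ ∑ xs f + ∑ ys f
∑-++ []       ys f = sym (+-identityˡ (∑ ys f))
∑-++ (x ∷ xs) ys f = trans (cong (_+_ (f x)) (∑-++ xs ys f)) (sym (+-assoc (f x) (∑ xs f) (∑ ys f)))

∑-map : (h : A → B) (xs : List A) (f : B → ℤ) → ∑ (map h xs) f ≡ ∑ xs (f ∘ h)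
∑-map h []       f = refl
∑-map h (x ∷ xs) f = cong (_+_ (f (h x))) (∑-map h xs f)

∑-cartesianProduct : (xs : List A) (ys : List B) (f : A × B → ℤ) →
                     ∑ (cartesianProduct xs ys) f ≡ ∑[ x ∈ xs ] ∑[ y ∈ ys ] f (x , y)
∑-cartesianProduct []       ys f = refl
∑-cartesianProduct (x ∷ xs) ys f =
  trans (∑-++ (map (x ,_) ys) (cartesianProduct xs ys) f)
        (cong₂ _+_ (∑-map (x ,_) ys f) (∑-cartesianProduct xs ys f))

∑-filter : {P : Pred A _} (P? : Decidable P) (xs : List A) (f : A → ℤ) →
           ∑ (filter P? xs) f ≡ ∑[ x ∈ xs ] ⟦ P? x ⟧ * f x
∑-filter P? []       f = refl
∑-filter P? (x ∷ xs) f with P? x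
... | yes _ = cong₂ _+_ (sym (*-identityˡ (f x))) (∑-filter P? xs f)
... | no  _ = trans (∑-filter P? xs f) (sym (+-identityˡ _))

length-filter : {P : Pred A _} (P? : Decidable P) (xs : List A) →
                + length (filter P? xs) ≡ ∑[ x ∈ xs ] ⟦ P? x ⟧
length-filter P? xs = begin
  + length (filter P? xs)                 ≡⟨ *-identityʳ _ ⟨
  + length (filter P? xs) * 1ℤ            ≡⟨ ∑-const (filter P? xs) 1ℤ ⟨
  ∑ (filter P? xs) (λ _ → 1ℤ)             ≡⟨ ∑-filter P? xs (λ _ → 1ℤ) ⟩
  ∑[ x ∈ xs ] ⟦ P? x ⟧ * 1ℤ               ≡⟨ ∑-cong xs (λ x → *-identityʳ ⟦ P? x ⟧) ⟩
  ∑[ x ∈ xs ] ⟦ P? x ⟧                    ∎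

pos-sum : (f : A → ℕ) (xs : List A) → + sum (map f xs) ≡ ∑[ x ∈ xs ] + f x
pos-sum f []       = refl
pos-sum f (x ∷ xs) = trans (pos-+ (f x) (sum (map f xs))) (cong (_+_ (+ f x)) (pos-sum f xs))

pos-^2 : ∀ k → + (k ℕ.^ 2) ≡ + k * + k
pos-^2 k = trans (pos-* k (k ℕ.* 1)) (cong (λ j → + k * + j) (ℕ.*-identityʳ k))

-- Membership supplies a nonzero bracket and uniqueness rules out a second one, so only the term at
-- `a` survives. Double sums below collapse by this sifting.
∑-δ : (_≟_ : DecidableEquality A) {a : A} {xs : List A} → Unique xs → a ∈ xs →
      (f : A → ℤ) → ∑[ x ∈ xs ] ⟦ a ≟ x ⟧ * f x ≡ f a
∑-δ _≟_ {a} {a ∷ xs} (a∉xs AllPairs.∷ _) (here refl) f = begin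
  ⟦ a ≟ a ⟧ * f a + ∑[ x ∈ xs ] ⟦ a ≟ x ⟧ * f x
    ≡⟨ cong₂ _+_ (cong (_* f a) (⟦⟧-true (a ≟ a) refl))
                 (∑-zero xs (λ x∈xs → cong (_* f _) (⟦⟧-false (a ≟ _) (All.lookup a∉xs x∈xs)))) ⟩
  1ℤ * f a + 0ℤ ≡⟨ +-identityʳ _ ⟩
  1ℤ * f a      ≡⟨ *-identityˡ (f a) ⟩
  f a           ∎
∑-δ _≟_ {a} {x ∷ xs} (x∉xs AllPairs.∷ uniq) (there a∈xs) f = begin
  ⟦ a ≟ x ⟧ * f x + ∑[ y ∈ xs ] ⟦ a ≟ y ⟧ * f y
    ≡⟨ cong₂ _+_ (cong (_* f x) (⟦⟧-false (a ≟ x) (All.lookup x∉xs a∈xs ∘ sym)))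
                 (∑-δ _≟_ uniq a∈xs f) ⟩
  0ℤ * f x + f a ≡⟨ +-identityˡ (f a) ⟩
  f a            ∎

∑-δ₁ : (_≟_ : DecidableEquality A) {a : A} {xs : List A} → Unique xs → a ∈ xs →
       ∑[ x ∈ xs ] ⟦ a ≟ x ⟧ ≡ 1ℤ
∑-δ₁ _≟_ {a} {xs} uniq a∈xs =
  trans (∑-cong xs (λ x → sym (*-identityʳ ⟦ a ≟ x ⟧))) (∑-δ _≟_ uniq a∈xs (λ _ → 1ℤ))

-- Degrees in the transformation graph are affine in `deg` or `D`, so the sum of their squares needs
-- only the number of terms and the first two power sums of `f`.
∑-affine² : (xs : List A) (a b : ℤ) (f : A → ℤ) →
            ∑[ x ∈ xs ] ((a + b * f x) * (a + b * f x)) ≡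
            + length xs * (a * a) + + 2 * a * b * ∑ xs f + b * b * (∑[ x ∈ xs ] (f x * f x))
∑-affine² []       a b f = base a b
  where
  base : ∀ a b → + 0 ≡ + 0 * (a * a) + + 2 * a * b * + 0 + b * b * + 0
  base = solve-∀
∑-affine² (x ∷ xs) a b f =
  trans (cong (_+_ ((a + b * f x) * (a + b * f x))) (∑-affine² xs a b f))
        (step a b (f x) (+ length xs) (∑ xs f) (∑[ x ∈ xs ] (f x * f x)))
  where
  step : ∀ a b y l S T →
         (a + b * y) * (a + b * y) + (l * (a * a) + + 2 * a * b * S + b * b * T) ≡
         (+ 1 + l) * (a * a) + + 2 * a * b * (y + S) + b * b * (y * y + T)
  step = solve-∀

-- Sums over indices, sign vectors and ordered pairs

∑-allFin-suc : ∀ k (f : Fin (ℕ.suc k) → ℤ) → ∑ (allFin (ℕ.suc k)) f ≡ f zero + ∑ (allFin k) (f ∘ suc)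
∑-allFin-suc k f = cong (_+_ (f zero))
  (trans (cong (λ is → ∑ is f) (sym (map-tabulate (λ i → i) suc))) (∑-map suc (allFin k) f))

-- An edge is a position in `edges`; this passes from positions to the pairs of ends stored there.
∑-lookup : (xs : List A) (f : A → ℤ) → ∑ (allFin (length xs)) (f ∘ lookup xs) ≡ ∑ xs f
∑-lookup xs f = trans (sym (∑-map (lookup xs) (allFin (length xs)) f))
  (cong (λ ys → ∑ ys f) (trans (map-tabulate (λ i → i) (lookup xs)) (tabulate-lookup xs)))

∑-allFin-const : ∀ k (c : ℤ) → ∑ (allFin k) (λ _ → c) ≡ + k * c
∑-allFin-const k c =
  trans (∑-const (allFin k) c) (cong (λ l → + l * c) (length-tabulate {n = k} (λ i → i)))

-- A copy influences the result only through its sign, hence the general `φ`. The induction peels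
-- off index 0, which is positive as soon as the bound is a successor; lowering index and bound
-- together preserves the sign by computation.
∑-firstPlus : ∀ {p r} → p ≤ⁿ r → (φ : Sign → ℤ) →
              ∑[ g ∈ allFin r ] φ (firstPlus p g) ≡ + p * φ Sign.+ + (+ r - + p) * φ Sign.-
∑-firstPlus {r = r} z≤n φ = trans (∑-allFin-const r (φ Sign.-)) (step (+ r) (φ Sign.+) (φ Sign.-))
  where
  step : ∀ r a b → r * b ≡ + 0 * a + (r - + 0) * b
  step = solve-∀
∑-firstPlus {ℕ.suc p} {ℕ.suc r} (s≤s p≤r) φ = begin
  ∑[ g ∈ allFin (ℕ.suc r) ] φ (firstPlus (ℕ.suc p) g)
    ≡⟨ ∑-allFin-suc r (λ g → φ (firstPlus (ℕ.suc p) g)) ⟩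
  φ Sign.+ + ∑[ g ∈ allFin r ] φ (firstPlus p g)
    ≡⟨ cong (_+_ (φ Sign.+)) (∑-firstPlus p≤r φ) ⟩
  φ Sign.+ + (+ p * φ Sign.+ + (+ r - + p) * φ Sign.-)
    ≡⟨ step (+ p) (+ r) (φ Sign.+) (φ Sign.-) ⟩
  + ℕ.suc p * φ Sign.+ + (+ ℕ.suc r - + ℕ.suc p) * φ Sign.- ∎
  where
  step : ∀ p r a b → a + (p * a + (r - p) * b) ≡ (+ 1 + p) * a + (+ 1 + r - (+ 1 + p)) * b
  step = solve-∀

-- The off-diagonal part of the square is covered by taking each entry of `pairs xs` in both orders.
-- In the induction a new head adds one row, one column and one diagonal term.
∑-square : (xs : List A) (G : A → A → ℤ) →
           ∑[ x ∈ xs ] ∑[ y ∈ xs ] G x y ≡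
           ∑ (pairs xs) (λ (x , y) → G x y + G y x) + ∑[ x ∈ xs ] G x x
∑-square []       G = refl
∑-square (x ∷ xs) G = begin
  G x x + ∑ xs (G x) + ∑[ u ∈ xs ] (G u x + ∑ xs (G u))
    ≡⟨ cong (_+_ (G x x + ∑ xs (G x)))
         (trans (∑-+ xs (λ u → G u x) (λ u → ∑ xs (G u))) (cong (_+_ (∑[ u ∈ xs ] G u x)) (∑-square xs G))) ⟩
  G x x + ∑ xs (G x) + (∑[ u ∈ xs ] G u x + (∑ (pairs xs) S + ∑[ u ∈ xs ] G u u))
    ≡⟨ step (G x x) (∑ xs (G x)) (∑[ u ∈ xs ] G u x) (∑ (pairs xs) S) (∑[ u ∈ xs ] G u u) ⟩
  ∑ xs (G x) + ∑[ u ∈ xs ] G u x + ∑ (pairs xs) S + (G x x + ∑[ u ∈ xs ] G u u)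
    ≡⟨ cong (λ t → t + ∑ (pairs xs) S + (G x x + ∑[ u ∈ xs ] G u u))
         (trans (sym (∑-+ xs (G x) (λ u → G u x))) (sym (∑-map (x ,_) xs S))) ⟩
  ∑ (map (x ,_) xs) S + ∑ (pairs xs) S + (G x x + ∑[ u ∈ xs ] G u u)
    ≡⟨ cong (_+ (G x x + ∑[ u ∈ xs ] G u u)) (sym (∑-++ (map (x ,_) xs) (pairs xs) S)) ⟩
  ∑ (pairs (x ∷ xs)) S + (G x x + ∑[ u ∈ xs ] G u u) ∎
  where
  S = λ (x , y) → G x y + G y x
  step : ∀ a b c d e → a + b + (c + (d + e)) ≡ b + c + d + (a + e)
  step = solve-∀

-- Counting neighbours under a sign

-- For `-` this is the degree in the complement; the `1ℤ` discounts the element itself.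
signedCount : Sign → ℤ → ℤ → ℤ
signedCount Sign.+ n k = k
signedCount Sign.- n k = n - 1ℤ - k

-- Since `R a` fails, `R x` already forces `a ≢ x`, which settles `+`. For `-`, the events `a ≡ x`
-- and `R x` exclude each other, so the bracket of avoiding both is linear in their brackets.
∑-signed : ∀ σ (_≟_ : DecidableEquality A) {a : A} {xs : List A} → Unique xs → a ∈ xs →
           {R : Pred A _} (R? : Decidable R) → ¬ R a →
           ∑[ x ∈ xs ] ⟦ ¬? (a ≟ x) ×-dec signed? σ (R? x) ⟧ ≡
           signedCount σ (+ length xs) (∑[ x ∈ xs ] ⟦ R? x ⟧)
∑-signed Sign.+ _≟_ {a} {xs} uniq a∈xs {R} R? ¬Ra =
  ∑-cong xs (λ x → ⟦⟧-cong (mk⇔ proj₂ (λ Rx → (λ a≡x → ¬Ra (subst R (sym a≡x) Rx)) , Rx))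
                           (¬? (a ≟ x) ×-dec R? x) (R? x))
∑-signed Sign.- _≟_ {a} {xs} uniq a∈xs {R} R? ¬Ra = begin
  ∑[ x ∈ xs ] ⟦ ¬? (a ≟ x) ×-dec ¬? (R? x) ⟧
    ≡⟨ ∑-cong xs pointwise ⟩
  ∑[ x ∈ xs ] (1ℤ - ⟦ a ≟ x ⟧ - ⟦ R? x ⟧)
    ≡⟨ ∑-- xs (λ x → 1ℤ - ⟦ a ≟ x ⟧) (λ x → ⟦ R? x ⟧) ⟩
  ∑[ x ∈ xs ] (1ℤ - ⟦ a ≟ x ⟧) - ∑[ x ∈ xs ] ⟦ R? x ⟧
    ≡⟨ cong (_- ∑[ x ∈ xs ] ⟦ R? x ⟧) (∑-- xs (λ _ → 1ℤ) (λ x → ⟦ a ≟ x ⟧)) ⟩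
  ∑[ x ∈ xs ] 1ℤ - ∑[ x ∈ xs ] ⟦ a ≟ x ⟧ - ∑[ x ∈ xs ] ⟦ R? x ⟧
    ≡⟨ cong₂ (λ l o → l - o - ∑[ x ∈ xs ] ⟦ R? x ⟧)
         (trans (∑-const xs 1ℤ) (*-identityʳ (+ length xs))) (∑-δ₁ _≟_ uniq a∈xs) ⟩
  + length xs - 1ℤ - ∑[ x ∈ xs ] ⟦ R? x ⟧ ∎
  where
  pointwise : ∀ x → ⟦ ¬? (a ≟ x) ×-dec ¬? (R? x) ⟧ ≡ 1ℤ - ⟦ a ≟ x ⟧ - ⟦ R? x ⟧
  pointwise x with a ≟ x | R? x
  ... | yes refl | yes Ra = ⊥-elim (¬Ra Ra)
  ... | yes _    | no _   = refl
  ... | no _     | yes _  = refl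
  ... | no _     | no _   = refl

-- Edge sums and incidence counts

module _ (Q : Graph) where

  open Graph Q hiding (order; size)

  private
    n m : ℤ
    n = + order Q
    m = + size Q

    es : List E
    es = allFin (size Q)

    tail head : E → V
    tail = proj₁ ∘ ends
    head = proj₂ ∘ ends

    deg : V → ℤ
    deg v = + degree v

    D : E → ℤ
    D e = deg (tail e) + deg (head e)

  ends-adjacent : ∀ e → tail e ~ head e
  ends-adjacent e = proj₂ (∈-filter⁻ (λ (u , v) → u ~? v) {xs = pairs vertices} (∈-lookup e))

  ends-distinct : ∀ e → tail e ≢ head e
  ends-distinct e eq = ~-irrefl (subst (_~ head e) eq (ends-adjacent e))

  deg-∑ : ∀ v → deg v ≡ ∑[ u ∈ vertices ] ⟦ v ~? u ⟧
  deg-∑ v = length-filter (v ~?_) vertices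

  -- Every edge accounts for the two ordered pairs (tail , head) and (head , tail).
  ∑-edges : (f : V → V → ℤ) →
            ∑[ e ∈ es ] (f (tail e) (head e) + f (head e) (tail e)) ≡
            ∑[ u ∈ vertices ] ∑[ v ∈ vertices ] ⟦ u ~? v ⟧ * f u v
  ∑-edges f = begin
    ∑[ e ∈ es ] (f (tail e) (head e) + f (head e) (tail e))
      ≡⟨ ∑-lookup edges S ⟩
    ∑ edges S
      ≡⟨ ∑-filter (λ (u , v) → u ~? v) (pairs vertices) S ⟩
    ∑ (pairs vertices) (λ (u , v) → ⟦ u ~? v ⟧ * (f u v + f v u))
      ≡⟨ ∑-cong (pairs vertices) symmetrise ⟩
    ∑ (pairs vertices) (λ (u , v) → G u v + G v u)
      -- The inserted zero is the diagonal of the square, which vanishes because there are no loops.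
      ≡⟨ +-identityʳ _ ⟨
    ∑ (pairs vertices) (λ (u , v) → G u v + G v u) + 0ℤ
      ≡⟨ cong (_+_ (∑ (pairs vertices) (λ (u , v) → G u v + G v u))) (∑-zero vertices (λ {u} _ → cong (_* f u u) (⟦⟧-false (u ~? u) ~-irrefl))) ⟨
    ∑ (pairs vertices) (λ (u , v) → G u v + G v u)
      + ∑[ u ∈ vertices ] G u u
      ≡⟨ ∑-square vertices G ⟨
    ∑[ u ∈ vertices ] ∑[ v ∈ vertices ] ⟦ u ~? v ⟧ * f u v ∎
    where
    G : V → V → ℤ
    G u v = ⟦ u ~? v ⟧ * f u v

    S : V × V → ℤ
    S (u , v) = f u v + f v u

    symmetrise : ∀ ((u , v) : V × V) →
      ⟦ u ~? v ⟧ * (f u v + f v u) ≡ G u v + G v u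
    symmetrise (u , v) = trans (*-distribˡ-+ ⟦ u ~? v ⟧ (f u v) (f v u))
      (cong (λ t → ⟦ u ~? v ⟧ * f u v + t * f v u) (⟦⟧-cong (mk⇔ ~-sym ~-sym) (u ~? v) (v ~? u)))

  -- A vertex occurs as an end once for each of its neighbours, and `f u` does not depend on the
  -- neighbour, so the inner sum in `∑-edges` becomes a degree.
  ∑-ends : (f : V → ℤ) → ∑[ e ∈ es ] (f (tail e) + f (head e)) ≡ ∑[ v ∈ vertices ] deg v * f v
  ∑-ends f = trans (∑-edges (λ u _ → f u)) (∑-cong vertices λ u → begin
    ∑[ v ∈ vertices ] ⟦ u ~? v ⟧ * f u   ≡⟨ ∑-cong vertices (λ v → *-comm ⟦ u ~? v ⟧ (f u)) ⟩
    ∑[ v ∈ vertices ] f u * ⟦ u ~? v ⟧   ≡⟨ ∑-*ˡ vertices (f u) (λ v → ⟦ u ~? v ⟧) ⟩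
    f u * (∑[ v ∈ vertices ] ⟦ u ~? v ⟧) ≡⟨ cong (f u *_) (deg-∑ u) ⟨
    f u * deg u                          ≡⟨ *-comm (f u) (deg u) ⟩
    deg u * f u                          ∎)

  -- Inclusion-exclusion, whose product term vanishes because an edge has two different ends.
  ⟦incident⟧ : ∀ v e → ⟦ incident? v e ⟧ ≡ ⟦ v ≟ tail e ⟧ + ⟦ v ≟ head e ⟧
  ⟦incident⟧ v e = begin
    ⟦ incident? v e ⟧
      ≡⟨ ⟦⟧-⊎ (v ≟ tail e) (v ≟ head e) ⟩
    ⟦ v ≟ tail e ⟧ + ⟦ v ≟ head e ⟧ - ⟦ v ≟ tail e ⟧ * ⟦ v ≟ head e ⟧
      ≡⟨ cong (_-_ (⟦ v ≟ tail e ⟧ + ⟦ v ≟ head e ⟧))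
           (⟦⟧-exclusive (v ≟ tail e) (v ≟ head e) (λ (p , q) → ends-distinct e (trans (sym p) q))) ⟩
    ⟦ v ≟ tail e ⟧ + ⟦ v ≟ head e ⟧ - 0ℤ
      ≡⟨ +-identityʳ _ ⟩
    ⟦ v ≟ tail e ⟧ + ⟦ v ≟ head e ⟧ ∎

  -- With the bracket of `v ≟ u` as weight, `∑-ends` turns the count into a sum over vertices that
  -- sifts out `deg v`.
  ∑-incident-edges : ∀ v → ∑[ e ∈ es ] ⟦ incident? v e ⟧ ≡ deg v
  ∑-incident-edges v = begin
    ∑[ e ∈ es ] ⟦ incident? v e ⟧                      ≡⟨ ∑-cong es (⟦incident⟧ v) ⟩
    ∑[ e ∈ es ] (⟦ v ≟ tail e ⟧ + ⟦ v ≟ head e ⟧)      ≡⟨ ∑-ends (λ u → ⟦ v ≟ u ⟧) ⟩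
    ∑[ u ∈ vertices ] deg u * ⟦ v ≟ u ⟧                ≡⟨ ∑-cong vertices (λ u → *-comm (deg u) ⟦ v ≟ u ⟧) ⟩
    ∑[ u ∈ vertices ] ⟦ v ≟ u ⟧ * deg u                ≡⟨ ∑-δ _≟_ unique (complete v) deg ⟩
    deg v                                              ∎

  ∑-incident-vertices : ∀ e → ∑[ v ∈ vertices ] ⟦ incident? v e ⟧ ≡ + 2
  ∑-incident-vertices e = begin
    ∑[ v ∈ vertices ] ⟦ incident? v e ⟧
      ≡⟨ ∑-cong vertices (λ v → trans (⟦incident⟧ v e) (cong₂ _+_ (flip v (tail e)) (flip v (head e)))) ⟩
    ∑[ v ∈ vertices ] (⟦ tail e ≟ v ⟧ + ⟦ head e ≟ v ⟧)
      ≡⟨ ∑-+ vertices (λ v → ⟦ tail e ≟ v ⟧) (λ v → ⟦ head e ≟ v ⟧) ⟩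
    ∑[ v ∈ vertices ] ⟦ tail e ≟ v ⟧ + ∑[ v ∈ vertices ] ⟦ head e ≟ v ⟧
      ≡⟨ cong₂ _+_ (∑-δ₁ _≟_ unique (complete (tail e))) (∑-δ₁ _≟_ unique (complete (head e))) ⟩
    + 2 ∎
    where
    -- `∑-δ` expects the fixed vertex on the left of the comparison.
    flip : ∀ u v → ⟦ u ≟ v ⟧ ≡ ⟦ v ≟ u ⟧
    flip u v = ⟦⟧-cong (mk⇔ sym sym) (u ≟ v) (v ≟ u)

  -- An edge meets both `a` and `b` exactly when it joins them, in one of two orientations. The sum
  -- over edges thus becomes a sum over ordered pairs, which sifts to the bracket of `a ~ b`.
  ∑-common-edges : ∀ {a b} → a ~ b → ∑[ e ∈ es ] ⟦ incident? a e ⟧ * ⟦ incident? b e ⟧ ≡ 1ℤ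
  ∑-common-edges {a} {b} a~b = begin
    ∑[ e ∈ es ] ⟦ incident? a e ⟧ * ⟦ incident? b e ⟧
      ≡⟨ ∑-cong es (λ e → trans (cong₂ _*_ (⟦incident⟧ a e) (⟦incident⟧ b e)) (expand e)) ⟩
    ∑[ e ∈ es ] (f (tail e) (head e) + f (head e) (tail e))
      ≡⟨ ∑-edges f ⟩
    ∑[ u ∈ vertices ] ∑[ v ∈ vertices ] ⟦ u ~? v ⟧ * (⟦ a ≟ u ⟧ * ⟦ b ≟ v ⟧)
      ≡⟨ ∑-cong vertices (λ u → begin
           ∑[ v ∈ vertices ] ⟦ u ~? v ⟧ * (⟦ a ≟ u ⟧ * ⟦ b ≟ v ⟧)
             ≡⟨ ∑-cong vertices (λ v → rearrange ⟦ u ~? v ⟧ ⟦ a ≟ u ⟧ ⟦ b ≟ v ⟧) ⟩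
           ∑[ v ∈ vertices ] ⟦ a ≟ u ⟧ * (⟦ b ≟ v ⟧ * ⟦ u ~? v ⟧)
             ≡⟨ ∑-*ˡ vertices ⟦ a ≟ u ⟧ (λ v → ⟦ b ≟ v ⟧ * ⟦ u ~? v ⟧) ⟩
           ⟦ a ≟ u ⟧ * (∑[ v ∈ vertices ] ⟦ b ≟ v ⟧ * ⟦ u ~? v ⟧)
             ≡⟨ cong (⟦ a ≟ u ⟧ *_) (∑-δ _≟_ unique (complete b) (λ v → ⟦ u ~? v ⟧)) ⟩
           ⟦ a ≟ u ⟧ * ⟦ u ~? b ⟧ ∎) ⟩
    ∑[ u ∈ vertices ] ⟦ a ≟ u ⟧ * ⟦ u ~? b ⟧
      ≡⟨ ∑-δ _≟_ unique (complete a) (λ u → ⟦ u ~? b ⟧) ⟩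
    ⟦ a ~? b ⟧
      ≡⟨ ⟦⟧-true (a ~? b) a~b ⟩
    1ℤ ∎
    where
    f : V → V → ℤ
    f u v = ⟦ a ≟ u ⟧ * ⟦ b ≟ v ⟧

    rearrange : ∀ x y z → x * (y * z) ≡ y * (z * x)
    rearrange = solve-∀

    not-both : ∀ u → ⟦ a ≟ u ⟧ * ⟦ b ≟ u ⟧ ≡ 0ℤ
    not-both u = ⟦⟧-exclusive (a ≟ u) (b ≟ u)
      (λ (a≡u , b≡u) → ~-irrefl (subst (_~ b) (trans a≡u (sym b≡u)) a~b))

    distrib : ∀ p q r s → (p + q) * (r + s) ≡ p * s + q * r + (p * r + q * s)
    distrib = solve-∀

    expand : ∀ e → (⟦ a ≟ tail e ⟧ + ⟦ a ≟ head e ⟧) * (⟦ b ≟ tail e ⟧ + ⟦ b ≟ head e ⟧) ≡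
                   f (tail e) (head e) + f (head e) (tail e)
    expand e = begin
      (⟦ a ≟ tail e ⟧ + ⟦ a ≟ head e ⟧) * (⟦ b ≟ tail e ⟧ + ⟦ b ≟ head e ⟧)
        ≡⟨ distrib ⟦ a ≟ tail e ⟧ ⟦ a ≟ head e ⟧ ⟦ b ≟ tail e ⟧ ⟦ b ≟ head e ⟧ ⟩
      f (tail e) (head e) + f (head e) (tail e)
        + (⟦ a ≟ tail e ⟧ * ⟦ b ≟ tail e ⟧ + ⟦ a ≟ head e ⟧ * ⟦ b ≟ head e ⟧)
        -- The leftover terms put `a` and `b` at the same end, which is impossible for adjacent,
        -- hence distinct, vertices.
        ≡⟨ cong (_+_ (f (tail e) (head e) + f (head e) (tail e))) (cong₂ _+_ (not-both (tail e)) (not-both (head e))) ⟩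
      f (tail e) (head e) + f (head e) (tail e) + 0ℤ
        ≡⟨ +-identityʳ _ ⟩
      f (tail e) (head e) + f (head e) (tail e) ∎

  adjacentEdges-irrefl : ∀ e → ¬ AdjacentEdges e e
  adjacentEdges-irrefl e (e≢e , _) = e≢e refl

  -- Inclusion-exclusion over the two ends of `e` detects the edges meeting `e`. Among them is `e`
  -- itself, whose bracket is therefore subtracted.
  ⟦adjacentEdges⟧ : ∀ e f → ⟦ adjacentEdges? e f ⟧ ≡
    ⟦ incident? (tail e) f ⟧ + ⟦ incident? (head e) f ⟧
      - ⟦ incident? (tail e) f ⟧ * ⟦ incident? (head e) f ⟧ - ⟦ e Fin.≟ f ⟧
  ⟦adjacentEdges⟧ e f = trans lemma (cong (_- ⟦ e Fin.≟ f ⟧) (⟦⟧-⊎ (incident? (tail e) f) (incident? (head e) f)))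
    where
    lemma : ⟦ adjacentEdges? e f ⟧ ≡ ⟦ incident? (tail e) f ⊎-dec incident? (head e) f ⟧ - ⟦ e Fin.≟ f ⟧
    lemma with e Fin.≟ f
    ... | yes refl = sym (cong (_- 1ℤ) (⟦⟧-true (incident? (tail e) e ⊎-dec incident? (head e) e) (inj₁ (inj₁ refl))))
    -- `map′` keeps the truth value, so the two sides differ only by a subtracted zero.
    ... | no _     = sym (+-identityʳ _)

  -- The stars of the two ends have `D e` edges in total. One unit is lost because they share
  -- exactly one edge, the other because `e` is not adjacent to itself.
  ∑-adjacentEdges : ∀ e → ∑[ f ∈ es ] ⟦ adjacentEdges? e f ⟧ ≡ D e - + 2
  ∑-adjacentEdges e = begin
    ∑[ f ∈ es ] ⟦ adjacentEdges? e f ⟧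
      ≡⟨ ∑-cong es (⟦adjacentEdges⟧ e) ⟩
    ∑[ f ∈ es ] (t f + h f - t f * h f - ⟦ e Fin.≟ f ⟧)
      ≡⟨ ∑-- es (λ f → t f + h f - t f * h f) (λ f → ⟦ e Fin.≟ f ⟧) ⟩
    ∑[ f ∈ es ] (t f + h f - t f * h f) - ∑[ f ∈ es ] ⟦ e Fin.≟ f ⟧
      ≡⟨ cong₂ _-_ (trans (∑-- es (λ f → t f + h f) (λ f → t f * h f)) (cong₂ _-_
           (trans (∑-+ es t h) (cong₂ _+_ (∑-incident-edges (tail e)) (∑-incident-edges (head e))))
           (∑-common-edges (ends-adjacent e))))
           (∑-δ₁ Fin._≟_ (Unique.allFin⁺ _) (∈-allFin e)) ⟩
    D e - 1ℤ - 1ℤ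
      ≡⟨ +-assoc (D e) (- 1ℤ) (- 1ℤ) ⟩
    D e - + 2 ∎
    where
    t h : E → ℤ
    t f = ⟦ incident? (tail e) f ⟧
    h f = ⟦ incident? (head e) f ⟧

  -- The indices of `Q` as integer sums

  M₁-∑ : + M₁ Q ≡ ∑[ v ∈ vertices ] deg v * deg v
  M₁-∑ = trans (pos-sum _ vertices) (∑-cong vertices (λ v → pos-^2 (degree v)))

  F-∑ : + F Q ≡ ∑[ v ∈ vertices ] deg v * (deg v * deg v)
  F-∑ = trans (pos-sum _ vertices) (∑-cong vertices (λ v →
    trans (pos-* (degree v) (degree v ℕ.^ 2)) (cong (deg v *_) (pos-^2 (degree v)))))

  M₂-∑ : + M₂ Q ≡ ∑[ e ∈ es ] deg (tail e) * deg (head e)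
  M₂-∑ = trans (pos-sum _ edges) (trans
    (∑-cong edges (λ (u , v) → pos-* (degree u) (degree v)))
    (sym (∑-lookup edges (λ (u , v) → deg u * deg v))))

  handshake : ∑ vertices deg ≡ + 2 * m
  handshake = begin
    ∑ vertices deg                       ≡⟨ ∑-cong vertices (λ v → *-identityʳ (deg v)) ⟨
    ∑[ v ∈ vertices ] deg v * 1ℤ         ≡⟨ ∑-ends (λ _ → 1ℤ) ⟨
    ∑ es (λ _ → + 2)                     ≡⟨ ∑-allFin-const (size Q) (+ 2) ⟩
    m * + 2                              ≡⟨ *-comm m (+ 2) ⟩
    + 2 * m                              ∎

  ∑-D : ∑ es D ≡ + M₁ Q
  ∑-D = trans (∑-ends deg) (sym M₁-∑)

  -- Squaring `D e` gives the squares of both end degrees, which `∑-ends` turns into cubes over the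
  -- vertices, and twice the summand of `M₂`.
  ∑-D² : ∑[ e ∈ es ] D e * D e ≡ + F Q + + 2 * + M₂ Q
  ∑-D² = begin
    ∑[ e ∈ es ] D e * D e
      ≡⟨ ∑-cong es (λ e → binomial (deg (tail e)) (deg (head e))) ⟩
    ∑[ e ∈ es ] (deg (tail e) * deg (tail e) + deg (head e) * deg (head e)
                  + + 2 * (deg (tail e) * deg (head e)))
      ≡⟨ ∑-+ es _ _ ⟩
    ∑[ e ∈ es ] (deg (tail e) * deg (tail e) + deg (head e) * deg (head e))
      + ∑[ e ∈ es ] + 2 * (deg (tail e) * deg (head e))
      ≡⟨ cong₂ _+_ (trans (∑-ends (λ v → deg v * deg v)) (sym F-∑))
                   (trans (∑-*ˡ es (+ 2) _) (cong (+ 2 *_) (sym M₂-∑))) ⟩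
    + F Q + + 2 * + M₂ Q ∎
    where
    binomial : ∀ a b → (a + b) * (a + b) ≡ a * a + b * b + + 2 * (a * b)
    binomial = solve-∀

  -- Degrees in the transformation graph

  module _ {r s : ℕ} (x : Vector Sign r) (y : Vector Sign s) where

    open Transformation Q x y allMinus using (graph)
    open Graph graph using () renaming (V to V′; _~?_ to _~′?_; degree to degree′; vertices to vertices′)

    ∑-vertices′ : (f : V′ → ℤ) → ∑ vertices′ f ≡
      ∑[ g ∈ allFin r ] ∑[ v ∈ vertices ] f (inj₁ (g , v)) +
      ∑[ h ∈ allFin s ] ∑[ e ∈ es ] f (inj₂ (h , e))
    ∑-vertices′ f = trans (∑-++ (map inj₁ (cartesianProduct (allFin r) vertices)) _ f) (cong₂ _+_
      (trans (∑-map inj₁ (cartesianProduct (allFin r) vertices) f) (∑-cartesianProduct (allFin r) vertices (f ∘ inj₁)))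
      (trans (∑-map inj₂ (cartesianProduct (allFin s) es) f) (∑-cartesianProduct (allFin s) es (f ∘ inj₂))))

    -- The neighbours lie in the same copy of `V`, where the sign decides their number, and in all
    -- `s` copies of `E`, each holding `m - deg v` edges not incident with `v`.
    degree-vertex : ∀ g v → + degree′ (inj₁ (g , v)) ≡ signedCount (x g) n (deg v) + + s * (m - deg v)
    degree-vertex g v = begin
      + degree′ (inj₁ (g , v))
        ≡⟨ length-filter (inj₁ (g , v) ~′?_) vertices′ ⟩
      ∑[ β ∈ vertices′ ] ⟦ inj₁ (g , v) ~′? β ⟧
        ≡⟨ ∑-vertices′ (λ β → ⟦ inj₁ (g , v) ~′? β ⟧) ⟩
      ∑[ g′ ∈ allFin r ] ∑[ u ∈ vertices ] ⟦ inj₁ (g , v) ~′? inj₁ (g′ , u) ⟧ +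
      ∑[ h ∈ allFin s ] ∑[ e ∈ es ] ⟦ inj₁ (g , v) ~′? inj₂ (h , e) ⟧
        ≡⟨ cong₂ _+_ same-kind other-kind ⟩
      signedCount (x g) n (deg v) + + s * (m - deg v) ∎
      where
      copies : Fin r → V → ℤ
      copies g′ u = ⟦ inj₁ (g , v) ~′? inj₁ (g′ , u) ⟧

      same-copy : V → ℤ
      same-copy u = ⟦ ¬? (v ≟ u) ×-dec signed? (x g) (v ~? u) ⟧

      -- The bracket of `g ≟ g′` splits off because different vertex copies are not linked; within
      -- one copy, distinctness reduces to that of the underlying vertices.
      split : ∀ g′ u → copies g′ u ≡ ⟦ g Fin.≟ g′ ⟧ * same-copy u
      split g′ u = trans
        (⟦⟧-cong (mk⇔ (λ { (α≢β , refl , l) → refl , (λ { refl → α≢β refl }) , l })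
                      (λ { (refl , v≢u , l) → (λ { refl → v≢u refl }) , refl , l }))
                 (inj₁ (g , v) ~′? inj₁ (g′ , u))
                 ((g Fin.≟ g′) ×-dec (¬? (v ≟ u) ×-dec signed? (x g) (v ~? u))))
        (⟦⟧-× (g Fin.≟ g′) (¬? (v ≟ u) ×-dec signed? (x g) (v ~? u)))

      same-kind : ∑[ g′ ∈ allFin r ] ∑[ u ∈ vertices ] copies g′ u ≡ signedCount (x g) n (deg v)
      same-kind = begin
        ∑[ g′ ∈ allFin r ] ∑[ u ∈ vertices ] copies g′ u
          ≡⟨ ∑-cong (allFin r) (λ g′ → trans (∑-cong vertices (split g′)) (∑-*ˡ vertices ⟦ g Fin.≟ g′ ⟧ same-copy)) ⟩
        ∑[ g′ ∈ allFin r ] ⟦ g Fin.≟ g′ ⟧ * ∑ vertices same-copy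
          ≡⟨ ∑-δ Fin._≟_ (Unique.allFin⁺ r) (∈-allFin g) (λ _ → ∑ vertices same-copy) ⟩
        ∑ vertices same-copy
          ≡⟨ ∑-signed (x g) _≟_ unique (complete v) (v ~?_) ~-irrefl ⟩
        signedCount (x g) n (∑[ u ∈ vertices ] ⟦ v ~? u ⟧)
          ≡⟨ cong (signedCount (x g) n) (deg-∑ v) ⟨
        signedCount (x g) n (deg v) ∎

      other-kind : ∑[ h ∈ allFin s ] ∑[ e ∈ es ] ⟦ inj₁ (g , v) ~′? inj₂ (h , e) ⟧ ≡ + s * (m - deg v)
      other-kind = begin
        ∑[ h ∈ allFin s ] ∑[ e ∈ es ] ⟦ inj₁ (g , v) ~′? inj₂ (h , e) ⟧
          ≡⟨ ∑-cong (allFin s) (λ h → ∑-cong es (λ e → trans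
               (⟦⟧-cong (mk⇔ proj₂ (λ l → (λ ()) , l)) (inj₁ (g , v) ~′? inj₂ (h , e)) (¬? (incident? v e)))
               (⟦⟧-¬ (incident? v e)))) ⟩
        ∑[ h ∈ allFin s ] ∑[ e ∈ es ] (1ℤ - ⟦ incident? v e ⟧)
          ≡⟨ ∑-allFin-const s _ ⟩
        + s * (∑[ e ∈ es ] (1ℤ - ⟦ incident? v e ⟧))
          ≡⟨ cong (+ s *_) (trans (∑-- es (λ _ → 1ℤ) (λ e → ⟦ incident? v e ⟧))
               (cong₂ _-_ (trans (∑-allFin-const (size Q) 1ℤ) (*-identityʳ m)) (∑-incident-edges v))) ⟩
        + s * (m - deg v) ∎

    -- The copy of `E` containing the edge contributes through `∑-adjacentEdges`, and each of the
    -- `r` copies of `V` contributes all vertices but the two ends.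
    degree-edge : ∀ h e → + degree′ (inj₂ (h , e)) ≡ signedCount (y h) m (D e - + 2) + + r * (n - + 2)
    degree-edge h e = begin
      + degree′ (inj₂ (h , e))
        ≡⟨ length-filter (inj₂ (h , e) ~′?_) vertices′ ⟩
      ∑[ β ∈ vertices′ ] ⟦ inj₂ (h , e) ~′? β ⟧
        ≡⟨ ∑-vertices′ (λ β → ⟦ inj₂ (h , e) ~′? β ⟧) ⟩
      ∑[ g ∈ allFin r ] ∑[ v ∈ vertices ] ⟦ inj₂ (h , e) ~′? inj₁ (g , v) ⟧ +
      ∑[ h′ ∈ allFin s ] ∑[ f ∈ es ] ⟦ inj₂ (h , e) ~′? inj₂ (h′ , f) ⟧
        ≡⟨ +-comm (∑[ g ∈ allFin r ] ∑[ v ∈ vertices ] ⟦ inj₂ (h , e) ~′? inj₁ (g , v) ⟧) _ ⟩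
      ∑[ h′ ∈ allFin s ] ∑[ f ∈ es ] ⟦ inj₂ (h , e) ~′? inj₂ (h′ , f) ⟧ +
      ∑[ g ∈ allFin r ] ∑[ v ∈ vertices ] ⟦ inj₂ (h , e) ~′? inj₁ (g , v) ⟧
        ≡⟨ cong₂ _+_ same-kind other-kind ⟩
      signedCount (y h) m (D e - + 2) + + r * (n - + 2) ∎
      where
      copies : Fin s → E → ℤ
      copies h′ f = ⟦ inj₂ (h , e) ~′? inj₂ (h′ , f) ⟧

      same-copy : E → ℤ
      same-copy f = ⟦ ¬? (e Fin.≟ f) ×-dec signed? (y h) (adjacentEdges? e f) ⟧

      split : ∀ h′ f → copies h′ f ≡ ⟦ h Fin.≟ h′ ⟧ * same-copy f
      split h′ f = trans
        (⟦⟧-cong (mk⇔ (λ { (α≢β , refl , l) → refl , (λ { refl → α≢β refl }) , l })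
                      (λ { (refl , e≢f , l) → (λ { refl → e≢f refl }) , refl , l }))
                 (inj₂ (h , e) ~′? inj₂ (h′ , f))
                 ((h Fin.≟ h′) ×-dec (¬? (e Fin.≟ f) ×-dec signed? (y h) (adjacentEdges? e f))))
        (⟦⟧-× (h Fin.≟ h′) (¬? (e Fin.≟ f) ×-dec signed? (y h) (adjacentEdges? e f)))

      same-kind : ∑[ h′ ∈ allFin s ] ∑[ f ∈ es ] copies h′ f ≡ signedCount (y h) m (D e - + 2)
      same-kind = begin
        ∑[ h′ ∈ allFin s ] ∑[ f ∈ es ] copies h′ f
          ≡⟨ ∑-cong (allFin s) (λ h′ → trans (∑-cong es (split h′)) (∑-*ˡ es ⟦ h Fin.≟ h′ ⟧ same-copy)) ⟩
        ∑[ h′ ∈ allFin s ] ⟦ h Fin.≟ h′ ⟧ * ∑ es same-copy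
          ≡⟨ ∑-δ Fin._≟_ (Unique.allFin⁺ s) (∈-allFin h) (λ _ → ∑ es same-copy) ⟩
        ∑ es same-copy
          ≡⟨ ∑-signed (y h) Fin._≟_ (Unique.allFin⁺ _) (∈-allFin e) (adjacentEdges? e) (adjacentEdges-irrefl e) ⟩
        signedCount (y h) (+ length es) (∑[ f ∈ es ] ⟦ adjacentEdges? e f ⟧)
          ≡⟨ cong₂ (signedCount (y h)) (cong +_ (length-tabulate {n = size Q} (λ i → i))) (∑-adjacentEdges e) ⟩
        signedCount (y h) m (D e - + 2) ∎

      other-kind : ∑[ g ∈ allFin r ] ∑[ v ∈ vertices ] ⟦ inj₂ (h , e) ~′? inj₁ (g , v) ⟧ ≡ + r * (n - + 2)
      other-kind = begin
        ∑[ g ∈ allFin r ] ∑[ v ∈ vertices ] ⟦ inj₂ (h , e) ~′? inj₁ (g , v) ⟧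
          ≡⟨ ∑-cong (allFin r) (λ g → ∑-cong vertices (λ v → trans
               (⟦⟧-cong (mk⇔ proj₂ (λ l → (λ ()) , l)) (inj₂ (h , e) ~′? inj₁ (g , v)) (¬? (incident? v e)))
               (⟦⟧-¬ (incident? v e)))) ⟩
        ∑[ g ∈ allFin r ] ∑[ v ∈ vertices ] (1ℤ - ⟦ incident? v e ⟧)
          ≡⟨ ∑-allFin-const r _ ⟩
        + r * (∑[ v ∈ vertices ] (1ℤ - ⟦ incident? v e ⟧))
          ≡⟨ cong (+ r *_) (trans (∑-- vertices (λ _ → 1ℤ) (λ v → ⟦ incident? v e ⟧))
               (cong₂ _-_ (trans (∑-const vertices 1ℤ) (*-identityʳ n)) (∑-incident-vertices e))) ⟩
        + r * (n - + 2) ∎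

  -- Sums of squared degrees over one copy

  -- The contribution of one vertex copy to `M₁`. It depends on the copy only through the sign,
  -- which is the form that `∑-firstPlus` takes.
  vertexSum : ℤ → Sign → ℤ
  vertexSum s σ = ∑[ v ∈ vertices ] (degree-in-copy v * degree-in-copy v)
    where
    degree-in-copy : V → ℤ
    degree-in-copy v = signedCount σ n (deg v) + s * (m - deg v)

  edgeSum : ℤ → Sign → ℤ
  edgeSum r σ = ∑[ e ∈ es ] (degree-in-copy e * degree-in-copy e)
    where
    degree-in-copy : E → ℤ
    degree-in-copy e = signedCount σ m (D e - + 2) + r * (n - + 2)

  M₁-transformation : ∀ {r s} (x : Vector Sign r) (y : Vector Sign s) →
    + M₁ (transformation Q x y allMinus) ≡
    ∑[ g ∈ allFin r ] vertexSum (+ s) (x g) + ∑[ h ∈ allFin s ] edgeSum (+ r) (y h)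
  M₁-transformation {r} {s} x y = begin
    + M₁ (transformation Q x y allMinus)
      ≡⟨ pos-sum (λ α → degree′ α ℕ.^ 2) vertices′ ⟩
    ∑[ α ∈ vertices′ ] + (degree′ α ℕ.^ 2)
      ≡⟨ ∑-cong vertices′ (λ α → pos-^2 (degree′ α)) ⟩
    ∑[ α ∈ vertices′ ] (+ degree′ α * + degree′ α)
      ≡⟨ ∑-vertices′ x y (λ α → + degree′ α * + degree′ α) ⟩
    ∑[ g ∈ allFin r ] ∑[ v ∈ vertices ] (+ degree′ (inj₁ (g , v)) * + degree′ (inj₁ (g , v))) +
    ∑[ h ∈ allFin s ] ∑[ e ∈ es ] (+ degree′ (inj₂ (h , e)) * + degree′ (inj₂ (h , e)))
      ≡⟨ cong₂ _+_
           (∑-cong (allFin r) (λ g → ∑-cong vertices (λ v → cong (λ d → d * d) (degree-vertex x y g v))))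
           (∑-cong (allFin s) (λ h → ∑-cong es (λ e → cong (λ d → d * d) (degree-edge x y h e)))) ⟩
    ∑[ g ∈ allFin r ] vertexSum (+ s) (x g) + ∑[ h ∈ allFin s ] edgeSum (+ r) (y h) ∎
    where open Graph (transformation Q x y allMinus) using () renaming (degree to degree′; vertices to vertices′)

  affine-vertexSum : ∀ a b → ∑[ v ∈ vertices ] ((a + b * deg v) * (a + b * deg v)) ≡
                     n * (a * a) + + 2 * a * b * (+ 2 * m) + b * b * + M₁ Q
  affine-vertexSum a b = trans (∑-affine² vertices a b deg)
    (cong₂ (λ S T → n * (a * a) + + 2 * a * b * S + b * b * T) handshake (sym M₁-∑))

  affine-edgeSum : ∀ a b → ∑[ e ∈ es ] ((a + b * D e) * (a + b * D e)) ≡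
                   m * (a * a) + + 2 * a * b * + M₁ Q + b * b * (+ F Q + + 2 * + M₂ Q)
  affine-edgeSum a b = trans (∑-affine² es a b D)
    (trans (cong (λ l → + l * (a * a) + + 2 * a * b * ∑ es D + b * b * (∑[ e ∈ es ] D e * D e))
                 (length-tabulate {n = size Q} (λ i → i)))
           (cong₂ (λ S T → m * (a * a) + + 2 * a * b * S + b * b * T) ∑-D ∑-D²))

  vertexSum-+ : ∀ s → vertexSum s Sign.+ ≡
    n * ((s * m) * (s * m)) + + 2 * (s * m) * (1ℤ - s) * (+ 2 * m) + (1ℤ - s) * (1ℤ - s) * + M₁ Q
  vertexSum-+ s = trans
    (∑-cong vertices (λ v → cong (λ d → d * d) (affine s m (deg v))))
    (affine-vertexSum (s * m) (1ℤ - s))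
    where
    affine : ∀ s m d → d + s * (m - d) ≡ s * m + (+ 1 - s) * d
    affine = solve-∀

  -- Each incident edge costs one neighbour in the complement and one in each of the `s` edge
  -- copies, hence the slope `- (s + 1ℤ)`.
  vertexSum-- : ∀ s → let a = n + s * m - 1ℤ; b = - (s + 1ℤ) in
    vertexSum s Sign.- ≡ n * (a * a) + + 2 * a * b * (+ 2 * m) + b * b * + M₁ Q
  vertexSum-- s = trans
    (∑-cong vertices (λ v → cong (λ d → d * d) (affine n s m (deg v))))
    (affine-vertexSum (n + s * m - 1ℤ) (- (s + 1ℤ)))
    where
    affine : ∀ n s m d → n - + 1 - d + s * (m - d) ≡ n + s * m - + 1 + - (s + + 1) * d
    affine = solve-∀

  -- In the intercept, `+ 2 * r` accounts for the two ends missed in each vertex copy, and the last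
  -- `+ 2` is the one in `D e - + 2`.
  edgeSum-+ : ∀ r → let a = n * r - + 2 * r - + 2 in
    edgeSum r Sign.+ ≡ m * (a * a) + + 2 * a * 1ℤ * + M₁ Q + 1ℤ * 1ℤ * (+ F Q + + 2 * + M₂ Q)
  edgeSum-+ r = trans
    (∑-cong es (λ e → cong (λ d → d * d) (affine n r (D e))))
    (affine-edgeSum (n * r - + 2 * r - + 2) 1ℤ)
    where
    affine : ∀ n r d → d - + 2 + r * (n - + 2) ≡ n * r - + 2 * r - + 2 + + 1 * d
    affine = solve-∀

  -- The `1ℤ` in the intercept is `- 1 + 2`: the edge itself is discounted, and the constant of
  -- `D e - + 2` changes sign in the complement.
  edgeSum-- : ∀ r → let a = m + r * (n - + 2) + 1ℤ; b = - 1ℤ in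
    edgeSum r Sign.- ≡ m * (a * a) + + 2 * a * b * + M₁ Q + b * b * (+ F Q + + 2 * + M₂ Q)
  edgeSum-- r = trans
    (∑-cong es (λ e → cong (λ d → d * d) (affine n r m (D e))))
    (affine-edgeSum (m + r * (n - + 2) + 1ℤ) (- 1ℤ))
    where
    affine : ∀ n r m d → m - + 1 - (d - + 2) + r * (n - + 2) ≡ m + r * (n - + 2) + + 1 + - (+ 1) * d
    affine = solve-∀

-- Assembling the formula

theorem3 :
  (Q : Graph) → Connected Q →
  (n m : ℕ) → order Q ≡ n → size Q ≡ m →
  (r s : ℕ) → 1 ≤ⁿ r → 1 ≤ⁿ s →
  (p q : ℕ) → 1 ≤ⁿ p → p ≤ⁿ r → 1 ≤ⁿ q → q ≤ⁿ s →
  let nℤ = + n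
      mℤ = + m
      rℤ = + r
      sℤ = + s
      pℤ = + p
      qℤ = + q
  in
  + M₁ (transformation Q {r} {s} (firstPlus p) (firstPlus q) allMinus)
  ≡ ( pℤ * (+ 1 - sℤ) ^ 2 + (rℤ - pℤ) * (sℤ + + 1) ^ 2
      + + 2 * qℤ * (nℤ * rℤ - + 2 * rℤ - + 2)
      + + 2 * (qℤ - sℤ) * (mℤ + rℤ * (nℤ - + 2) + + 1) ) * + M₁ Q
    + + 2 * sℤ * + M₂ Q
    + sℤ * + F Q
    + (rℤ - pℤ) * ( nℤ * (nℤ + sℤ * mℤ - + 1) ^ 2
                    - + 4 * mℤ * (nℤ + sℤ * mℤ - + 1) * (sℤ + + 1) )
    + pℤ * sℤ * mℤ ^ 2 * (nℤ * sℤ + + 4 * (+ 1 - sℤ))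
    + mℤ * qℤ * (nℤ * rℤ - + 2 * rℤ - + 2) ^ 2
    + mℤ * (sℤ - qℤ) * (mℤ + rℤ * (nℤ - + 2) + + 1) ^ 2
theorem3 Q _ n m refl refl r s _ _ p q _ p≤r _ q≤s = begin
  + M₁ (transformation Q {r} {s} (firstPlus p) (firstPlus q) allMinus)
    ≡⟨ M₁-transformation Q {r} {s} (firstPlus p) (firstPlus q) ⟩
  ∑[ g ∈ allFin r ] vertexSum Q (+ s) (firstPlus p g) + ∑[ h ∈ allFin s ] edgeSum Q (+ r) (firstPlus q h)
    -- Copies of the same kind and sign contribute equally, leaving four values weighted by `p`,
    -- `r - p`, `q` and `s - q`.
    ≡⟨ cong₂ _+_ (∑-firstPlus p≤r (vertexSum Q (+ s))) (∑-firstPlus q≤s (edgeSum Q (+ r))) ⟩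
  + p * vertexSum Q (+ s) Sign.+ + (+ r - + p) * vertexSum Q (+ s) Sign.- +
  (+ q * edgeSum Q (+ r) Sign.+ + (+ s - + q) * edgeSum Q (+ r) Sign.-)
    ≡⟨ cong₂ _+_
         (cong₂ (λ a b → + p * a + (+ r - + p) * b) (vertexSum-+ Q (+ s)) (vertexSum-- Q (+ s)))
         (cong₂ (λ a b → + q * a + (+ s - + q) * b) (edgeSum-+ Q (+ r)) (edgeSum-- Q (+ r))) ⟩
  _ ≡⟨ collect (+ n) (+ m) (+ r) (+ s) (+ p) (+ q) (+ M₁ Q) (+ M₂ Q) (+ F Q) ⟩
  _ ∎
  where
  open Integer.+-*-Solver using (solve; _:=_; con; _:+_; _:-_; _:*_; _:^_; :-_)

  -- Both edge slopes square to 1, so `F + + 2 * M₂` receives the weight `q + (s - q) = s`. The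
  -- negative edge slope turns `s - q` into the `q - s` in the coefficient of `M₁`.
  collect : ∀ n m r s p q M₁ M₂ F →
    p * (n * ((s * m) * (s * m)) + + 2 * (s * m) * (1ℤ - s) * (+ 2 * m) + (1ℤ - s) * (1ℤ - s) * M₁) +
    (r - p) * (n * ((n + s * m - 1ℤ) * (n + s * m - 1ℤ))
               + + 2 * (n + s * m - 1ℤ) * - (s + 1ℤ) * (+ 2 * m) + - (s + 1ℤ) * - (s + 1ℤ) * M₁) +
    (q * (m * ((n * r - + 2 * r - + 2) * (n * r - + 2 * r - + 2))
          + + 2 * (n * r - + 2 * r - + 2) * 1ℤ * M₁ + 1ℤ * 1ℤ * (F + + 2 * M₂)) +
     (s - q) * (m * ((m + r * (n - + 2) + 1ℤ) * (m + r * (n - + 2) + 1ℤ))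
                + + 2 * (m + r * (n - + 2) + 1ℤ) * - 1ℤ * M₁ + - 1ℤ * - 1ℤ * (F + + 2 * M₂)))
    ≡ ( p * (+ 1 - s) ^ 2 + (r - p) * (s + + 1) ^ 2
        + + 2 * q * (n * r - + 2 * r - + 2)
        + + 2 * (q - s) * (m + r * (n - + 2) + + 1) ) * M₁
      + + 2 * s * M₂
      + s * F
      + (r - p) * ( n * (n + s * m - + 1) ^ 2
                      - + 4 * m * (n + s * m - + 1) * (s + + 1) )
      + p * s * m ^ 2 * (n * s + + 4 * (+ 1 - s))
      + m * q * (n * r - + 2 * r - + 2) ^ 2
      + m * (s - q) * (m + r * (n - + 2) + + 1) ^ 2
  collect = solve 9 (λ n m r s p q M₁ M₂ F →
    let one = con 1ℤ
        two = con (+ 2)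
        four = con (+ 4)
        -- `a` and `b` are intercept and slope for a negative vertex copy; `c` and `d` are the
        -- intercepts for positive and negative edge copies.
        a = n :+ s :* m :- one
        b = :- (s :+ one)
        c = n :* r :- two :* r :- two
        d = m :+ r :* (n :- two) :+ one
    in
    p :* (n :* ((s :* m) :* (s :* m)) :+ two :* (s :* m) :* (one :- s) :* (two :* m) :+ (one :- s) :* (one :- s) :* M₁) :+
    (r :- p) :* (n :* (a :* a) :+ two :* a :* b :* (two :* m) :+ b :* b :* M₁) :+
    (q :* (m :* (c :* c) :+ two :* c :* one :* M₁ :+ one :* one :* (F :+ two :* M₂)) :+
     (s :- q) :* (m :* (d :* d) :+ two :* d :* :- one :* M₁ :+ :- one :* :- one :* (F :+ two :* M₂)))
    := ( p :* (one :- s) :^ 2 :+ (r :- p) :* (s :+ one) :^ 2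
         :+ two :* q :* c :+ two :* (q :- s) :* d ) :* M₁
       :+ two :* s :* M₂
       :+ s :* F
       :+ (r :- p) :* (n :* a :^ 2 :- four :* m :* a :* (s :+ one))
       :+ p :* s :* m :^ 2 :* (n :* s :+ four :* (one :- s))
       :+ m :* q :* c :^ 2
       :+ m :* (s :- q) :* d :^ 2) refl
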